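{- Let $\Lambda$ be an index set and let $(G_\lambda,d_\lambda)$, $\lambda\in\Lambda$, be groups with two-sided invariant metrics. Let $A$ be a subgroup of every $G_\lambda$ which is closed in each $G_\lambda$, assume $G_{\lambda_1}\cap G_{\lambda_2}=A$ for $\lambda_1\neq\lambda_2$, and assume $d_{\lambda_1}(a_1,a_2)=d_{\lambda_2}(a_1,a_2)$ for all $a_1,a_2\in A$ and all $\lambda_1,\lambda_2\in\Lambda$. Let $\underline{d}$ be the function on $\coprod_A G_\lambda$ defined in the context. Then: (i) $\underline{d}$ is a two-sided invariant metric on $\coprod_A G_\lambda$ (in particular $\underline d(f,e)=0$ implies $f=e$); (ii) $\underline{d}$ extends the amalgam metric $d$ on $G=\bigcup_\lambda G_\lambda$, i.e. $\underline d(g_1,g_2)=d(g_1,g_2)$ for all $g_1,g_2\in G$.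
   Context: $\coprod_A G_\lambda$ denotes the free product of the groups $G_\lambda$ with amalgamation over $A$; $G=\bigcup_\lambda G_\lambda\subseteq \coprod_A G_\lambda$. The amalgam metric $d$ on $G$ is: $d(f_1,f_2)=d_\lambda(f_1,f_2)$ if $f_1,f_2\in G_\lambda$ for some $\lambda$; and $d(f_1,f_2)=\inf_{a\in A}\{d_{\lambda_1}(f_1,a)+d_{\lambda_2}(a,f_2)\}$ if $f_1\in G_{\lambda_1}$, $f_2\in G_{\lambda_2}$ with $\lambda_1\ne\lambda_2$ (and they do not lie in a common $G_\lambda$). For finite nonempty words $\alpha=\alpha(1)\cdots\alpha(n)$ over the alphabet $G$, $\hat\alpha=\alpha(1)\cdot\alpha(2)\cdots\alpha(n)$ is the product in $\coprod_A G_\lambda$, and for words $\alpha,\beta$ of the same length $n$, $\rho(\alpha,\beta)=\sum_{i=1}^n d(\alpha(i),\beta(i))$. Define $\underline d(f_1,f_2)=\inf\{\rho(\alpha_1,\alpha_2): |\alpha_1|=|\alpha_2|,\ \hat\alpha_1=f_1,\ \hat\alpha_2=f_2\}$ for $f_1,f_2\in\coprod_A G_\lambda$ (the Graev metric on the amalgam). -}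

module Defs where

open import Level using (Level; Setω; 0ℓ; _⊔_) renaming (suc to lsuc)
open import Algebra.Bundles using (Group; CommutativeRing)
open import Algebra.Core using (Op₁)
open import Algebra.Morphism.Structures using (module GroupMorphisms)
open import Axiom.ExcludedMiddle using (ExcludedMiddle)
open import Data.List.Base as List using (List; []; _∷_; _++_; length)
open import Data.List.Properties using (++-assoc; ++-identityʳ)
open import Data.Nat.Base using (ℕ; suc)
open import Data.Product.Base using (Σ; ∃; Σ-syntax; ∃-syntax; _×_; _,_; proj₁; proj₂)
open import Data.Vec.Base as Vec using (Vec; []; _∷_)
open import Function.Metric.Structures using (IsGeneralMetric)
open import Relation.Binary.Core using (Rel)
open import Relation.Binary.PropositionalEquality using (_≡_; refl)
open import Relation.Binary.Structures using (IsTotalOrder; IsEquivalence)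
open import Relation.Nullary.Decidable.Core using (yes; no)
open import Relation.Nullary.Negation.Core using (¬_)

import Relation.Binary.Construct.NonStrictToStrict as ToStrict

-- The real numbers, characterised as a Dedekind-complete ordered field.
-- Classically this determines them up to unique isomorphism.

record CompleteOrderedField : Setω where
  infix 4 _≤_ _<_
  field
    commutativeRing : CommutativeRing 0ℓ 0ℓ
  open CommutativeRing commutativeRing public
  field
    0≉1          : ¬ (0# ≈ 1#)
    inverse      : ∀ x → ¬ (x ≈ 0#) → ∃[ y ] (x * y ≈ 1#)
    _≤_          : Rel Carrier 0ℓ
    isTotalOrder : IsTotalOrder _≈_ _≤_
    +-monoˡ-≤    : ∀ z {x y} → x ≤ y → x + z ≤ y + z
    *-nonNeg     : ∀ {x y} → 0# ≤ x → 0# ≤ y → 0# ≤ x * y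

  _<_ : Rel Carrier 0ℓ
  _<_ = ToStrict._<_ _≈_ _≤_

  IsUpperBound : ∀ {s} → (Carrier → Set s) → Carrier → Set s
  IsUpperBound S b = ∀ x → S x → x ≤ b

  IsSupremum : ∀ {s} → (Carrier → Set s) → Carrier → Set s
  IsSupremum S b = IsUpperBound S b × (∀ b′ → IsUpperBound S b′ → b ≤ b′)

  field
    complete : ∀ {s} (S : Carrier → Set s) →
               ∃ S → ∃ (IsUpperBound S) → ∃ (IsSupremum S)

module Real (ℝ : CompleteOrderedField) where
  open CompleteOrderedField ℝ using (_≤_; _≈_; 0#; _+_; complete; isTotalOrder)
    renaming (Carrier to R)
  module ≤ = IsTotalOrder isTotalOrder

  -- The infimum of a nonempty family of nonnegative reals, obtained as the
  -- supremum of its set of lower bounds.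

  module _ {i} {I : Set i} (F : I → R) (i₀ : I) (F≥0 : ∀ j → 0# ≤ F j) where

    private
      sup : ∃ _
      sup = complete (λ x → ∀ j → x ≤ F j) (0# , F≥0) (F i₀ , λ _ lb → lb i₀)

    inf : R
    inf = proj₁ sup

    inf-lower : ∀ j → inf ≤ F j
    inf-lower j = proj₂ (proj₂ sup) (F j) (λ _ lb → lb j)

    inf-greatest : ∀ x → (∀ j → x ≤ F j) → x ≤ inf
    inf-greatest = proj₁ (proj₂ sup)

    inf-nonNeg : 0# ≤ inf
    inf-nonNeg = inf-greatest 0# F≥0

  +-nonNeg : ∀ {x y} → 0# ≤ x → 0# ≤ y → 0# ≤ x + y
  +-nonNeg {x} {y} 0≤x 0≤y =
    ≤.trans 0≤y (≤.≤-respˡ-≈ (ℝ.+-identityˡ y) (ℝ.+-monoˡ-≤ y 0≤x))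
    where module ℝ = CompleteOrderedField ℝ

  record IsInvariantMetric {c ℓ} (H : Group c ℓ)
                           (d : Group.Carrier H → Group.Carrier H → R)
                           : Set (c ⊔ ℓ) where
    private module H = Group H
    field
      isMetric        : IsGeneralMetric H._≈_ _≈_ _≤_ 0# _+_ d
      left-invariant  : ∀ f x y → d (f H.∙ x) (f H.∙ y) ≈ d x y
      right-invariant : ∀ f x y → d (x H.∙ f) (y H.∙ f) ≈ d x y

    open IsGeneralMetric isMetric public
      using (nonNegative; cong; ≈⇒0; 0⇒≈; sym; triangle)

-- The common subgroup A is given by embeddings ι λ : A → G λ; the condition
-- that distinct factors meet exactly in A is built into the equality _≈ᴳ_ on
-- the union of the factors below.  λ₀ makes the index set nonempty: with no
-- factors there are no nonempty words to take the infimum over.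

record MetricAmalgam (ℝ : CompleteOrderedField) (l c ℓ a ℓₐ : Level)
                     : Set (lsuc (l ⊔ c ⊔ ℓ ⊔ a ⊔ ℓₐ)) where
  open CompleteOrderedField ℝ using (_≈_; _<_; 0#) renaming (Carrier to R)
  open Real ℝ using (IsInvariantMetric)
  field
    Λ     : Set l
    λ₀    : Λ
    G     : Λ → Group c ℓ
    dist  : ∀ i → Group.Carrier (G i) → Group.Carrier (G i) → R
    A     : Group a ℓₐ
    ι     : ∀ i → Group.Carrier A → Group.Carrier (G i)

  module G i = Group (G i)
  module A = Group A

  field
    dist-invariantMetric : ∀ i → IsInvariantMetric (G i) (dist i)
    ι-monomorphism       : ∀ i → GroupMorphisms.IsGroupMonomorphism
                             (Group.rawGroup A) (Group.rawGroup (G i)) (ι i)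
    A-closed             : ∀ i (g : G.Carrier i) →
                           (∀ ε → 0# < ε → ∃[ b ] (dist i g (ι i b) < ε)) →
                           ∃[ b ] (G._≈_ i g (ι i b))
    dist-agree           : ∀ i j b₁ b₂ →
                           dist i (ι i b₁) (ι i b₂) ≈ dist j (ι j b₁) (ι j b₂)

module Amalgam (lem : ∀ {p} → ExcludedMiddle p) (ℝ : CompleteOrderedField)
               {l c ℓ a ℓₐ : Level} (M : MetricAmalgam ℝ l c ℓ a ℓₐ) where
  open MetricAmalgam M
  open CompleteOrderedField ℝ using (_≤_; 0#; _+_) renaming (Carrier to R)
  open Real ℝ

  -- The union G of the factors: the disjoint union with the images of A
  -- identified.

  Letter : Set (l ⊔ c)
  Letter = Σ Λ G.Carrier

  infix 4 _≈ᴳ_ _∼_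

  data _≈ᴳ_ : Rel Letter (l ⊔ c ⊔ ℓ ⊔ a) where
    same : ∀ {i x y} → G._≈_ i x y → (i , x) ≈ᴳ (i , y)
    glue : ∀ {i j x y} b → G._≈_ i x (ι i b) → G._≈_ j y (ι j b) →
           (i , x) ≈ᴳ (j , y)

  -- The free product with amalgamation: words over the factors modulo the
  -- congruence generated by the multiplication tables and the gluing along A.

  data _∼_ : Rel (List Letter) (l ⊔ c ⊔ ℓ ⊔ a) where
    ∼-refl  : ∀ {u} → u ∼ u
    ∼-sym   : ∀ {u v} → u ∼ v → v ∼ u
    ∼-trans : ∀ {u v w} → u ∼ v → v ∼ w → u ∼ w
    ++-cong : ∀ {u u′ v v′} → u ∼ u′ → v ∼ v′ → u ++ v ∼ u′ ++ v′
    letter  : ∀ {f g} → f ≈ᴳ g → f ∷ [] ∼ g ∷ []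
    mul     : ∀ {i x y} → (i , x) ∷ (i , y) ∷ [] ∼ (i , G._∙_ i x y) ∷ []
    unit    : ∀ {i} → (i , G.ε i) ∷ [] ∼ []

  private
    ∼-isEquivalence : IsEquivalence _∼_
    ∼-isEquivalence = record { refl = ∼-refl ; sym = ∼-sym ; trans = ∼-trans }

    ≡⇒∼ : ∀ {u v} → u ≡ v → u ∼ v
    ≡⇒∼ refl = ∼-refl

  invᴸ : Letter → Letter
  invᴸ (i , x) = i , G._⁻¹ i x

  inv : Op₁ (List Letter)
  inv []      = []
  inv (f ∷ w) = inv w ++ invᴸ f ∷ []

  private
    inv-++ : ∀ u v → inv (u ++ v) ≡ inv v ++ inv u
    inv-++ []      v rewrite ++-identityʳ (inv v) = refl
    inv-++ (f ∷ u) v rewrite inv-++ u v = ++-assoc (inv v) (inv u) (invᴸ f ∷ [])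

    invᴸ-cong : ∀ {f g} → f ≈ᴳ g → invᴸ f ≈ᴳ invᴸ g
    invᴸ-cong (same {i} p) = same (G.⁻¹-cong i p)
    invᴸ-cong (glue {i} {j} b p q) = glue (b A.⁻¹) (lift i p) (lift j q)
      where
      lift : ∀ k {x} → G._≈_ k x (ι k b) → G._≈_ k (G._⁻¹ k x) (ι k (b A.⁻¹))
      lift k r = G.trans k (G.⁻¹-cong k r) (G.sym k (Mono.⁻¹-homo b))
        where module Mono = GroupMorphisms.IsGroupMonomorphism (ι-monomorphism k)

    letter-inverseʳ : ∀ f → f ∷ invᴸ f ∷ [] ∼ []
    letter-inverseʳ (i , x) =
      ∼-trans mul (∼-trans (letter (same (G.inverseʳ i x))) unit)

    letter-inverseˡ : ∀ f → invᴸ f ∷ f ∷ [] ∼ []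
    letter-inverseˡ (i , x) =
      ∼-trans mul (∼-trans (letter (same (G.inverseˡ i x))) unit)

    inverseʳ : ∀ w → w ++ inv w ∼ []
    inverseʳ []      = ∼-refl
    inverseʳ (f ∷ w) = ∼-trans
      (++-cong {f ∷ []} ∼-refl
        (∼-trans (≡⇒∼ (reassoc w (inv w) (invᴸ f ∷ [])))
                 (++-cong (inverseʳ w) ∼-refl)))
      (letter-inverseʳ f)
      where
      reassoc : ∀ (u v t : List Letter) → u ++ (v ++ t) ≡ (u ++ v) ++ t
      reassoc u v t rewrite ++-assoc u v t = refl

    inverseˡ : ∀ w → inv w ++ w ∼ []
    inverseˡ []      = ∼-refl
    inverseˡ (f ∷ w) = ∼-trans
      (≡⇒∼ (++-assoc (inv w) (invᴸ f ∷ []) (f ∷ w)))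
      (∼-trans
        (++-cong {inv w} ∼-refl (++-cong (letter-inverseˡ f) (∼-refl {w})))
        (inverseˡ w))

    cancel : ∀ {x u v y} → x ++ u ∼ [] → v ++ y ∼ [] → u ∼ v → x ∼ y
    cancel {x} {u} {v} {y} p q r = ∼-trans
      (≡⇒∼ (++-identityʳ′ x))
      (∼-trans (++-cong (∼-refl {x}) (∼-sym q))
      (∼-trans (++-cong (∼-refl {x}) (++-cong (∼-sym r) (∼-refl {y})))
      (∼-trans (∼-sym (≡⇒∼ (++-assoc x u y)))
               (++-cong p ∼-refl))))
      where
      ++-identityʳ′ : ∀ (w : List Letter) → w ≡ w ++ []
      ++-identityʳ′ w rewrite ++-identityʳ w = refl

    inv-cong : ∀ {u v} → u ∼ v → inv u ∼ inv v
    inv-cong {u} {v} p = cancel (inverseˡ u) (inverseʳ v) p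

  ∐ : Group (l ⊔ c) (l ⊔ c ⊔ ℓ ⊔ a)
  ∐ = record
    { Carrier = List Letter
    ; _≈_     = _∼_
    ; _∙_     = _++_
    ; ε       = []
    ; _⁻¹     = inv
    ; isGroup = record
      { isMonoid = record
        { isSemigroup = record
          { isMagma = record { isEquivalence = ∼-isEquivalence ; ∙-cong = ++-cong }
          ; assoc   = λ u v w → ≡⇒∼ (++-assoc u v w)
          }
        ; identity = (λ _ → ∼-refl) , (λ w → ≡⇒∼ (++-identityʳ w))
        }
      ; inverse = inverseˡ , inverseʳ
      ; ⁻¹-cong = inv-cong
      }
    }

  module ∐ = Group ∐

  η : Letter → ∐.Carrier
  η f = f ∷ []

  InFactor : Λ → Letter → Set (l ⊔ c ⊔ ℓ ⊔ a)
  InFactor i f = Σ[ x ∈ G.Carrier i ] (f ≈ᴳ (i , x))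

  private
    dist-nonNeg : ∀ i x y → 0# ≤ dist i x y
    dist-nonNeg i x y = IsInvariantMetric.nonNegative (dist-invariantMetric i)

  through : (f₁ f₂ : Letter) → A.Carrier → R
  through (i₁ , x₁) (i₂ , x₂) b = dist i₁ x₁ (ι i₁ b) + dist i₂ (ι i₂ b) x₂

  through-nonNeg : ∀ f₁ f₂ b → 0# ≤ through f₁ f₂ b
  through-nonNeg (i₁ , x₁) (i₂ , x₂) b =
    +-nonNeg (dist-nonNeg i₁ x₁ (ι i₁ b)) (dist-nonNeg i₂ (ι i₂ b) x₂)

  -- The amalgam metric on G, by cases on whether f₁ and f₂ lie in a common
  -- factor (hence lem).  In that case the value does not depend on the factor
  -- chosen, since the metrics agree on A.

  d : Letter → Letter → R
  d f₁ f₂ with lem {P = ∃[ i ] (InFactor i f₁ × InFactor i f₂)}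
  ... | yes (i , (x₁ , _) , (x₂ , _)) = dist i x₁ x₂
  ... | no _ = inf (through f₁ f₂) A.ε (through-nonNeg f₁ f₂)

  d-nonNeg : ∀ f₁ f₂ → 0# ≤ d f₁ f₂
  d-nonNeg f₁ f₂ with lem {P = ∃[ i ] (InFactor i f₁ × InFactor i f₂)}
  ... | yes (i , (x₁ , _) , (x₂ , _)) = dist-nonNeg i x₁ x₂
  ... | no _ = inf-nonNeg (through f₁ f₂) A.ε (through-nonNeg f₁ f₂)

  eval : ∀ {n} → Vec Letter n → ∐.Carrier
  eval []      = ∐.ε
  eval (f ∷ α) = η f ∐.∙ eval α

  ρ : ∀ {n} → Vec Letter n → Vec Letter n → R
  ρ []      []      = 0#
  ρ (f ∷ α) (g ∷ β) = d f g + ρ α β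

  ρ-nonNeg : ∀ {n} (α β : Vec Letter n) → 0# ≤ ρ α β
  ρ-nonNeg []      []      = ≤.refl
  ρ-nonNeg (f ∷ α) (g ∷ β) = +-nonNeg (d-nonNeg f g) (ρ-nonNeg α β)

  record WordPair (f₁ f₂ : ∐.Carrier) : Set (l ⊔ c ⊔ ℓ ⊔ a) where
    field
      {n}   : ℕ
      α₁ α₂ : Vec Letter (suc n)
      eval₁ : eval α₁ ∐.≈ f₁
      eval₂ : eval α₂ ∐.≈ f₂

  open WordPair

  somePair : ∀ f₁ f₂ → WordPair f₁ f₂
  somePair f₁ f₂ = record
    { α₁    = e ∷ Vec.fromList f₁ Vec.++ Vec.replicate (length f₂) e
    ; α₂    = e ∷ Vec.replicate (length f₁) e Vec.++ Vec.fromList f₂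
    ; eval₁ = ++-cong unit (padʳ f₁ (length f₂))
    ; eval₂ = ++-cong unit (padˡ f₂ (length f₁))
    }
    where
    e : Letter
    e = λ₀ , G.ε λ₀

    eval-fromList : ∀ w → eval (Vec.fromList w) ∼ w
    eval-fromList []      = ∼-refl
    eval-fromList (f ∷ w) = ++-cong (∼-refl {f ∷ []}) (eval-fromList w)

    eval-replicate : ∀ n → eval (Vec.replicate n e) ∼ []
    eval-replicate 0       = ∼-refl
    eval-replicate (suc n) = ++-cong unit (eval-replicate n)

    padʳ : ∀ w n → eval (Vec.fromList w Vec.++ Vec.replicate n e) ∼ w
    padʳ []      n = eval-replicate n
    padʳ (f ∷ w) n = ++-cong (∼-refl {f ∷ []}) (padʳ w n)

    padˡ : ∀ w n → eval (Vec.replicate n e Vec.++ Vec.fromList w) ∼ w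
    padˡ w 0       = eval-fromList w
    padˡ w (suc n) = ++-cong unit (padˡ w n)

  d̲ : ∐.Carrier → ∐.Carrier → R
  d̲ f₁ f₂ = inf {I = WordPair f₁ f₂} (λ w → ρ (α₁ w) (α₂ w)) (somePair f₁ f₂)
                (λ w → ρ-nonNeg (α₁ w) (α₂ w))

{-# OPTIONS --safe #-}
-- Proof idea.  Evaluate a word in a factor G i by multiplying letters of G i
-- and collapsing subwords, recursively, to elements of A; moving a value from
-- x to y costs dist x y.  In a block collapsed to A the first letter can be
-- split off, and the rest of the block can be evaluated in the factor of that
-- letter, at the same cost.  Hence the cost of collapsing a word to the
-- identity does not change under cyclic rotation, and therefore depends only on
-- the element of the free product that the word represents; replacing a letter
-- f by g changes it by at most d f g.  So d̲ u v is at least the cost of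
-- collapsing u v⁻¹.  For a product of two letters f g⁻¹ this cost is at least
-- d f g; for a nonempty reduced word it is at least the least distance from one
-- of its letters to A, which is positive because A is closed.

module Submission where

open import Defs
open import Level using (Level; 0ℓ; _⊔_)
open import Algebra.Bundles using (CommutativeMonoid; Group)
open import Algebra.Morphism.Structures using (module GroupMorphisms)
open import Axiom.ExcludedMiddle using (ExcludedMiddle)
open import Data.List.Base using (List; []; _∷_; _++_)
open import Data.List.Properties using (++-assoc; ++-identityʳ)
open import Data.List.Relation.Unary.All as All using (All; []; _∷_)
open import Data.List.Relation.Unary.All.Properties as Allₚ using ()
open import Data.List.Relation.Unary.Linked as Linked using (Linked; []; [-]; _∷_)
open import Data.Product using (∃-syntax; _×_; _,_; proj₁; proj₂)
open import Data.Sum.Base using (_⊎_; inj₁; inj₂)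
open import Data.Vec.Base as Vec using (Vec; []; _∷_)
open import Relation.Binary.Bundles using (Poset)
open import Relation.Binary.PropositionalEquality as ≡ using (_≡_; _≢_)
open import Relation.Nullary using (¬_; yes; no; contradiction)

import Algebra.Properties.CommutativeSemigroup as CommutativeSemigroupProperties
import Algebra.Properties.Group as GroupProperties
import Relation.Binary.Construct.NonStrictToStrict as ToStrict
import Relation.Binary.Reasoning.PartialOrder as PartialOrderReasoning
import Relation.Binary.Reasoning.Setoid as SetoidReasoning

-- Order arithmetic and infima in the reals

module RealProperties (ℝ : CompleteOrderedField) where
  open CompleteOrderedField ℝ
    using (_≤_; _≈_; 0#; _+_; -_; +-monoˡ-≤) renaming (Carrier to R)
  open Real ℝ
  private module ℝ = CompleteOrderedField ℝ

  poset : Poset 0ℓ 0ℓ 0ℓ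
  poset = record { isPartialOrder = ≤.isPartialOrder }

  module ≤-Reasoning = PartialOrderReasoning poset

  open CommutativeSemigroupProperties
    (CommutativeMonoid.commutativeSemigroup ℝ.+-commutativeMonoid)
    public using (x∙yz≈y∙xz)

  ≈⇒≤ : ∀ {x y} → x ≈ y → x ≤ y
  ≈⇒≤ = ≤.reflexive

  ≈⇒≥ : ∀ {x y} → x ≈ y → y ≤ x
  ≈⇒≥ p = ≤.reflexive (ℝ.sym p)

  +-monoʳ-≤ : ∀ z {x y} → x ≤ y → z + x ≤ z + y
  +-monoʳ-≤ z {x} {y} p = begin
    z + x ≈⟨ ℝ.+-comm z x ⟩
    x + z ≤⟨ +-monoˡ-≤ z p ⟩
    y + z ≈⟨ ℝ.+-comm y z ⟩
    z + y ∎
    where open ≤-Reasoning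

  +-mono-≤ : ∀ {x y u v} → x ≤ y → u ≤ v → x + u ≤ y + v
  +-mono-≤ {y = y} {u = u} p q = ≤.trans (+-monoˡ-≤ u p) (+-monoʳ-≤ y q)

  x+0≤x : ∀ {x} → x + 0# ≤ x
  x+0≤x = ≈⇒≤ (ℝ.+-identityʳ _)

  x≤x+nonNeg : ∀ {x y} → 0# ≤ y → x ≤ x + y
  x≤x+nonNeg {x} p = ≤.trans (≈⇒≥ (ℝ.+-identityʳ x)) (+-monoʳ-≤ x p)

  ∸-≤⇒≤-+ : ∀ {x y z} → x + - y ≤ z → x ≤ z + y
  ∸-≤⇒≤-+ {x} {y} {z} p = begin
    x             ≈⟨ GroupProperties.//-rightDividesˡ ℝ.+-group y x ⟨
    (x + - y) + y ≤⟨ +-monoˡ-≤ y p ⟩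
    z + y         ∎
    where open ≤-Reasoning

  ≤-+⇒∸-≤ : ∀ {x y z} → x ≤ z + y → x + - y ≤ z
  ≤-+⇒∸-≤ {x} {y} {z} p = begin
    x + - y       ≤⟨ +-monoˡ-≤ (- y) p ⟩
    (z + y) + - y ≈⟨ GroupProperties.//-rightDividesʳ ℝ.+-group y z ⟩
    z             ∎
    where open ≤-Reasoning

  ≤-inf-+ : ∀ {i} {I : Set i} (F : I → R) i₀ F≥0 {x y} →
            (∀ j → x ≤ F j + y) → x ≤ inf F i₀ F≥0 + y
  ≤-inf-+ F i₀ F≥0 p =
    ∸-≤⇒≤-+ (inf-greatest F i₀ F≥0 _ (λ j → ≤-+⇒∸-≤ (p j)))

-- Isometries of a group with a two-sided invariant metric

module InvariantMetricProperties
  (ℝ : CompleteOrderedField) {c ℓ : Level} (H : Group c ℓ)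
  {d : Group.Carrier H → Group.Carrier H → CompleteOrderedField.Carrier ℝ}
  (isInvariantMetric : Real.IsInvariantMetric ℝ H d) where

  open CompleteOrderedField ℝ using (_≈_; setoid)
  open Group H using (_∙_; _⁻¹; _\\_; ε)
  open Real.IsInvariantMetric isInvariantMetric
  open SetoidReasoning setoid
  private module H = Group H
  open GroupProperties H

  \\-isometry : ∀ g x y → d (g \\ x) (g \\ y) ≈ d x y
  \\-isometry g = left-invariant (g ⁻¹)

  d-ε-\\ : ∀ g x → d ε (g \\ x) ≈ d g x
  d-ε-\\ g x = begin
    d ε (g \\ x)             ≈⟨ left-invariant g ε (g \\ x) ⟨
    d (g ∙ ε) (g ∙ (g \\ x)) ≈⟨ cong (H.identityʳ g) (\\-leftDividesˡ g x) ⟩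
    d g x                    ∎

  d-translate : ∀ x y → d y (x ∙ y) ≈ d ε x
  d-translate x y = begin
    d y (x ∙ y)       ≈⟨ cong (H.identityˡ y) H.refl ⟨
    d (ε ∙ y) (x ∙ y) ≈⟨ right-invariant y ε x ⟩
    d ε x             ∎

  d-inverse : ∀ x y → d (y \\ ε) (x \\ ε) ≈ d x y
  d-inverse x y = begin
    d (y \\ ε) (x \\ ε)             ≈⟨ cong (H.identityʳ _) (H.identityʳ _) ⟩
    d (y ⁻¹) (x ⁻¹)                 ≈⟨ left-invariant x _ _ ⟨
    d (x ∙ y ⁻¹) (x ∙ x ⁻¹)         ≈⟨ cong H.refl xx⁻¹≈yy⁻¹ ⟩
    d (x ∙ y ⁻¹) (y ∙ y ⁻¹)         ≈⟨ right-invariant (y ⁻¹) x y ⟩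
    d x y                           ∎
    where
    xx⁻¹≈yy⁻¹ : x ∙ x ⁻¹ H.≈ y ∙ y ⁻¹
    xx⁻¹≈yy⁻¹ = H.trans (H.inverseʳ x) (H.sym (H.inverseʳ y))

module _ (lem : ∀ {p} → ExcludedMiddle p) (ℝ : CompleteOrderedField)
         {l c ℓ a ℓₐ : Level} (M : MetricAmalgam ℝ l c ℓ a ℓₐ) where
  open MetricAmalgam M
  open CompleteOrderedField ℝ using (_≤_; _<_; _≈_; 0#; _+_) renaming (Carrier to R)
  open Real ℝ
  open RealProperties ℝ
  open Amalgam lem ℝ M
  private
    module ℝ = CompleteOrderedField ℝ
    module GP i = GroupProperties (G i)
    module ιᴹ i = GroupMorphisms.IsGroupMonomorphism (ι-monomorphism i)
    module D i = IsInvariantMetric (dist-invariantMetric i)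
    module DP i = InvariantMetricProperties ℝ (G i) (dist-invariantMetric i)
    open module Factor {i} = Group (G i) using (_∙_; _\\_; ε)
    variable
      b : A.Carrier
      i j k : Λ
      x y z : G.Carrier i
      f g h : Letter
      u v w : List Letter
      r s t : R

  dist-refl : ∀ i x → dist i x x ≤ 0#
  dist-refl i x = ≈⇒≤ (D.≈⇒0 i (G.refl i))

  ι-\\ : ∀ i b b′ → G._≈_ i (ι i (b A.\\ b′)) (ι i b \\ ι i b′)
  ι-\\ i b b′ = G.trans i (ιᴹ.∙-homo i (b A.⁻¹) b′) (G.∙-congʳ i (ιᴹ.⁻¹-homo i b))

  -- The union of the factors

  ≈ᴳ-refl : f ≈ᴳ f
  ≈ᴳ-refl {i , x} = same (G.refl i)

  ≈ᴳ-sym : f ≈ᴳ g → g ≈ᴳ f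
  ≈ᴳ-sym (same {i} p)  = same (G.sym i p)
  ≈ᴳ-sym (glue b p q) = glue b q p

  ≈ᴳ-trans : f ≈ᴳ g → g ≈ᴳ h → f ≈ᴳ h
  ≈ᴳ-trans (same {i} p)  (same q)       = same (G.trans i p q)
  ≈ᴳ-trans (same {i} p)  (glue b q q′) = glue b (G.trans i p q) q′
  ≈ᴳ-trans (glue {j = j} b p p′) (same q) = glue b p (G.trans j (G.sym j q) p′)
  ≈ᴳ-trans (glue {j = j} b p p′) (glue {j = k} b′ q q′) =
    glue b p (G.trans k q′ (ιᴹ.⟦⟧-cong k
      (ιᴹ.injective j (G.trans j (G.sym j q) p′))))

  ≈ᴳ-injective : (i , x) ≈ᴳ (i , y) → G._≈_ i x y
  ≈ᴳ-injective (same p)          = p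
  ≈ᴳ-injective (glue {i} b p q) = G.trans i p (G.sym i q)

  ≈ᴳ-ι : ∀ i j b → (i , ι i b) ≈ᴳ (j , ι j b)
  ≈ᴳ-ι i j b = glue b (G.refl i) (G.refl j)

  ≈ᴳ-ε : ∀ i j → (i , ε) ≈ᴳ (j , ε)
  ≈ᴳ-ε i j = glue A.ε (G.sym i (ιᴹ.ε-homo i)) (G.sym j (ιᴹ.ε-homo j))

  ≈ᴳ-ι-\\ : ∀ b → (i , x) ≈ᴳ (j , y) → (i , ι i b \\ x) ≈ᴳ (j , ι j b \\ y)
  ≈ᴳ-ι-\\ b (same {i} p)     = same (G.∙-congˡ i p)
  ≈ᴳ-ι-\\ b (glue b′ p q) = glue (b A.\\ b′) (lift _ p) (lift _ q)
    where
    lift : ∀ k {x} → G._≈_ k x (ι k b′) → G._≈_ k (ι k b \\ x) (ι k (b A.\\ b′))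
    lift k p = G.trans k (G.∙-congˡ k p) (G.sym k (ι-\\ k b b′))

  ≈ᴳ-\\-ε : (i , x) ≈ᴳ (j , y) → (i , x \\ ε) ≈ᴳ (j , y \\ ε)
  ≈ᴳ-\\-ε (same {i} p)  = same (G.∙-congʳ i (G.⁻¹-cong i p))
  ≈ᴳ-\\-ε (glue b p q) = glue (b A.\\ A.ε) (lift _ p) (lift _ q)
    where
    lift : ∀ k {x} → G._≈_ k x (ι k b) → G._≈_ k (x \\ ε) (ι k (b A.\\ A.ε))
    lift k p = G.trans k (GP.\\-cong₂ k p (G.sym k (ιᴹ.ε-homo k))) (G.sym k (ι-\\ k b A.ε))

  dist-≈ᴳ : ∀ {x′ y′} → (i , x) ≈ᴳ (j , x′) → (i , y) ≈ᴳ (j , y′) →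
            dist i x y ≈ dist j x′ y′
  dist-≈ᴳ (same {i} p) (same q) = D.cong i p q
  dist-≈ᴳ (same {i} p) (glue b q q′) =
    D.cong i p (G.trans i q (G.sym i q′))
  dist-≈ᴳ (glue {i} b p p′) (same q) =
    D.cong i (G.trans i p (G.sym i p′)) q
  dist-≈ᴳ (glue {i} {j} b p p′) (glue b′ q q′) =
    ℝ.trans (D.cong i p q) (ℝ.trans (dist-agree i j b b′)
      (D.cong j (G.sym j p′) (G.sym j q′)))

  -- Frees `d` from the common factor and representatives that `lem` happened to select.
  d-common : f ≈ᴳ (i , x) → g ≈ᴳ (i , y) → d f g ≈ dist i x y
  d-common {f} {i} {x} {g} {y} p q
    with lem {P = ∃[ i ] (InFactor i f × InFactor i g)}
  ... | yes (j , (x′ , p′) , (y′ , q′)) =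
        dist-≈ᴳ (≈ᴳ-trans (≈ᴳ-sym p′) p) (≈ᴳ-trans (≈ᴳ-sym q′) q)
  ... | no ∄i = contradiction (i , (x , p) , (y , q)) ∄i

  d-refl : ∀ f → d f f ≈ 0#
  d-refl (i , x) = ℝ.trans (d-common ≈ᴳ-refl ≈ᴳ-refl) (D.≈⇒0 i (G.refl i))

  d-≤-through : ∀ f g b → d f g ≤ through f g b
  d-≤-through f@(i , x) g@(j , y) b
    with lem {P = ∃[ i ] (InFactor i f × InFactor i g)}
  ... | yes (k , (x′ , p) , (y′ , q)) = begin
        dist k x′ y′                               ≤⟨ D.triangle k _ _ _ ⟩
        dist k x′ (ι k b) + dist k (ι k b) y′      ≈⟨ ℝ.+-cong (dist-≈ᴳ p (≈ᴳ-ι i k b))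
                                                               (dist-≈ᴳ (≈ᴳ-ι j k b) q) ⟨
        dist i x (ι i b) + dist j (ι j b) y        ∎
        where open ≤-Reasoning
  ... | no _ = inf-lower (through f g) A.ε (through-nonNeg f g) b

  through-sym : ∀ f g b → through f g b ≈ through g f b
  through-sym (i , x) (j , y) b =
    ℝ.trans (ℝ.+-comm _ _) (ℝ.+-cong (D.sym j _ _) (D.sym i _ _))

  d-sym-≤ : ∀ f g → d f g ≤ d g f
  d-sym-≤ f g with lem {P = ∃[ i ] (InFactor i g × InFactor i f)}
  ... | yes (i , (y , q) , (x , p)) = ≈⇒≤ (ℝ.trans (d-common p q) (D.sym i x y))
  ... | no _ = inf-greatest (through g f) A.ε (through-nonNeg g f) _ (λ b →
        ≤.trans (d-≤-through f g b) (≈⇒≤ (through-sym f g b)))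

  -- Deformations of words

  -- In Deform w i x r, w evaluates to x in G i at cost at most r.  The target
  -- is divided by each letter or block read, so cost is paid only in nil.
  data Deform : List Letter → ∀ i → G.Carrier i → R → Set (l ⊔ c ⊔ a) where
    nil    : dist i ε x ≤ r → Deform [] i x r
    letter : ∀ g → Deform w i (g \\ x) r → Deform ((i , g) ∷ w) i x r
    block  : ∀ u v b → u ++ v ≡ w → Deform (f ∷ u) j (ι j b) s →
             Deform v i (ι i b \\ x) t → s + t ≤ r → Deform (f ∷ w) i x r

  Deform-nonNeg : Deform w i x r → 0# ≤ r
  Deform-nonNeg (nil {i} p)              = ≤.trans (D.nonNegative i) p
  Deform-nonNeg (letter _ D)             = Deform-nonNeg D
  Deform-nonNeg (block _ _ _ _ D₁ D₂ p) =
    ≤.trans (+-nonNeg (Deform-nonNeg D₁) (Deform-nonNeg D₂)) p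

  -- Left invariance carries the displacement of the target past every letter and block; the
  -- triangle inequality pays for it in `nil`.
  Deform-move : Deform w i x r → dist i x y + r ≤ s → Deform w i y s
  Deform-move {i = i} {x} {r} {y} {s} (nil p) q = nil (begin
    dist i ε y              ≤⟨ D.triangle i _ _ _ ⟩
    dist i ε x + dist i x y ≤⟨ ℝ.+-monoˡ-≤ _ p ⟩
    r + dist i x y          ≈⟨ ℝ.+-comm _ _ ⟩
    dist i x y + r          ≤⟨ q ⟩
    s                       ∎)
    where open ≤-Reasoning
  Deform-move {i = i} (letter g D) q =
    letter g (Deform-move D (≤.trans (≈⇒≤ (ℝ.+-congʳ (DP.\\-isometry i g _ _))) q))
  Deform-move {i = i} {x} {r} {y} (block {s = s₁} {t = t₁} u v b eq D₁ D₂ p) q =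
    block u v b eq D₁ (Deform-move D₂ ≤.refl) (begin
      s₁ + (dist i (ι i b \\ x) (ι i b \\ y) + t₁) ≈⟨ ℝ.+-congˡ (ℝ.+-congʳ (DP.\\-isometry i _ _ _)) ⟩
      s₁ + (dist i x y + t₁)                       ≈⟨ x∙yz≈y∙xz _ _ _ ⟩
      dist i x y + (s₁ + t₁)                       ≤⟨ +-monoʳ-≤ _ p ⟩
      dist i x y + r                               ≤⟨ q ⟩
      _                                            ∎)
    where open ≤-Reasoning

  Deform-weaken : r ≤ s → Deform w i x r → Deform w i x s
  Deform-weaken {r} {i = i} p D = Deform-move D
    (≤.trans (ℝ.+-monoˡ-≤ r (dist-refl i _)) (≤.trans (≈⇒≤ (ℝ.+-identityˡ r)) p))

  Deform-resp : G._≈_ i x y → Deform w i x r → Deform w i y r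
  Deform-resp {i} p D =
    Deform-move D (≈⇒≤ (ℝ.trans (ℝ.+-congʳ (D.≈⇒0 i p)) (ℝ.+-identityˡ _)))

  -- Across factors the target lies in `A`, so a nonempty word becomes one block of the new factor
  -- with nothing left to pay. The empty word cannot form a block; for it the agreement of the
  -- metrics is used.
  Deform-≈ᴳ : (i , x) ≈ᴳ (j , y) → Deform w i x r → Deform w j y r
  Deform-≈ᴳ {i} {j = j} {w = []} p (nil q) =
    nil (≤.trans (≈⇒≥ (dist-≈ᴳ (≈ᴳ-ε i j) p)) q)
  Deform-≈ᴳ {w = _ ∷ _} (same p) D = Deform-resp p D
  Deform-≈ᴳ {j = j} {w = f ∷ w} (glue b p q) D =
    block w [] b (++-identityʳ w) (Deform-resp p D)
      (nil (≈⇒≤ (ℝ.trans (DP.d-ε-\\ j _ _) (D.≈⇒0 j (G.sym j q))))) x+0≤x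

  -- Once `u` is read, the cost left in its `nil` moves the target of `v` from `y` to `x ∙ y`; right
  -- invariance makes the two distances equal.
  Deform-++ : Deform u i x r → Deform v i y s → r + s ≤ t →
              Deform (u ++ v) i (x ∙ y) t
  Deform-++ {i = i} (nil p) D q =
    Deform-move D
      (≤.trans (ℝ.+-monoˡ-≤ _ (≤.trans (≈⇒≤ (DP.d-translate i _ _)) p)) q)
  Deform-++ {i = i} (letter g D) D′ q =
    letter g (Deform-resp (G.assoc i _ _ _) (Deform-++ D D′ q))
  Deform-++ {i = i} {v = v′} (block u v b ≡.refl D₁ D₂ p) D′ q =
    block u (v ++ v′) b (≡.sym (++-assoc u v v′)) D₁
      (Deform-resp (G.assoc i _ _ _) (Deform-++ D₂ D′ ≤.refl))
      (≤.trans (≈⇒≥ (ℝ.+-assoc _ _ _)) (≤.trans (ℝ.+-monoˡ-≤ _ p) q))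

  -- When the block containing the first letter is opened up, its remaining
  -- parts can be evaluated in the factor of that letter, because the value of
  -- the block lies in A.
  Deform-uncons : Deform ((i , z) ∷ w) j x r → (j , x) ≈ᴳ (i , y) →
                  Deform w i (z \\ y) r
  Deform-uncons {i} (letter z D) p = Deform-resp (G.∙-congˡ i (≈ᴳ-injective p)) D
  Deform-uncons {i} {z} {y = y} (block {j = k} u v b ≡.refl D₁ D₂ q) p =
    Deform-resp
      (G.trans i (G.assoc i _ _ _) (G.∙-congˡ i (GP.\\-leftDividesˡ i (ι i b) y)))
      (Deform-++ (Deform-uncons D₁ (≈ᴳ-ι k i b)) (Deform-≈ᴳ (≈ᴳ-ι-\\ b p) D₂) q)

  -- Collapsing words to the identity: rotation and invariance under `∼`

  Null : List Letter → R → Set (l ⊔ c ⊔ a)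
  Null w r = Deform w λ₀ ε r

  Null-[] : Null [] 0#
  Null-[] = nil (dist-refl λ₀ ε)

  -- Together with `Null-cons`: collapsing a word is the same, at equal cost, as deforming its tail
  -- to the inverse of the first letter, in the factor of that letter.
  Null-uncons : Null ((i , x) ∷ w) r → Deform w i (x \\ ε) r
  Null-uncons D = Deform-uncons D (≈ᴳ-ε _ _)

  Null-cons : Deform w i (x \\ ε) r → Null ((i , x) ∷ w) r
  Null-cons D = Deform-≈ᴳ (≈ᴳ-ε _ _) (letter _ D)

  Null-move : Null ((i , y) ∷ w) r → Null ((i , x) ∷ w) (dist i x y + r)
  Null-move {i = i} D =
    Null-cons (Deform-move (Null-uncons D) (≈⇒≤ (ℝ.+-congʳ (DP.d-inverse i _ _))))

  -- The tail `w` deforms to the inverse of `x` in the factor of `x`, and appending `x` itself then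
  -- gives the identity for free.
  Null-rotate₁ : ∀ f w → Null (f ∷ w) r → Null (w ++ f ∷ []) r
  Null-rotate₁ (i , x) w D = Deform-≈ᴳ (≈ᴳ-ε i λ₀)
    (Deform-resp (G.trans i (G.∙-congʳ i (G.identityʳ i _)) (G.inverseˡ i x))
      (Deform-++ (Null-uncons D) (letter x (nil dist≤0)) x+0≤x))
    where
    dist≤0 : dist i ε (x \\ x) ≤ 0#
    dist≤0 = ≤.trans (≈⇒≤ (DP.d-ε-\\ i x x)) (dist-refl i x)

  Null-rotate : ∀ u v → Null (u ++ v) r → Null (v ++ u) r
  Null-rotate         []      v D = ≡.subst (λ w → Null w _) (≡.sym (++-identityʳ v)) D
  Null-rotate {r = r} (f ∷ u) v D = ≡.subst (λ w → Null w r) (++-assoc v (f ∷ []) u)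
    (Null-rotate u (v ++ f ∷ [])
      (≡.subst (λ w → Null w r) (++-assoc u v (f ∷ [])) (Null-rotate₁ f (u ++ v) D)))

  infix 4 _⊑_

  -- The context `w` makes the relation compatible with concatenation; by rotation a right context
  -- stands for any context.
  _⊑_ : List Letter → List Letter → Set (l ⊔ c ⊔ a)
  u ⊑ v = ∀ w {r} → Null (u ++ w) r → Null (v ++ w) r

  -- Rotation brings the rewritten subword to the front.
  ⊑-++ : ∀ {u u′ v v′} → u ⊑ u′ → v ⊑ v′ → u ++ v ⊑ u′ ++ v′
  ⊑-++ {u} {u′} {v} {v′} p q w {r} D =
    cast (≡.sym (++-assoc u′ v′ w))
      (Null-rotate (v′ ++ w) u′ (cast (≡.sym (++-assoc v′ w u′))
        (q (w ++ u′) (cast (++-assoc v w u′)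
          (Null-rotate u′ (v ++ w) (p (v ++ w) (cast (++-assoc u v w) D)))))))
    where
    cast : ∀ {u v} → u ≡ v → Null u r → Null v r
    cast = ≡.subst (λ w → Null w r)

  ⊑-letter : f ≈ᴳ g → f ∷ [] ⊑ g ∷ []
  ⊑-letter p w D = Null-cons (Deform-≈ᴳ (≈ᴳ-\\-ε p) (Null-uncons D))

  -- Both directions are proved in one induction, because `∼-sym` exchanges them.
  ∼⇒⊑⊒ : u ∼ v → u ⊑ v × v ⊑ u
  ∼⇒⊑⊒ ∼-refl        = (λ _ D → D) , (λ _ D → D)
  ∼⇒⊑⊒ (∼-sym p)     = let q , q′ = ∼⇒⊑⊒ p in q′ , q
  ∼⇒⊑⊒ (∼-trans p q) =
    let p₁ , p₂ = ∼⇒⊑⊒ p ; q₁ , q₂ = ∼⇒⊑⊒ q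
    in (λ w D → q₁ w (p₁ w D)) , (λ w D → p₂ w (q₂ w D))
  ∼⇒⊑⊒ (++-cong p q) =
    let p₁ , p₂ = ∼⇒⊑⊒ p ; q₁ , q₂ = ∼⇒⊑⊒ q
    in ⊑-++ p₁ q₁ , ⊑-++ p₂ q₂
  ∼⇒⊑⊒ (letter p) = ⊑-letter p , ⊑-letter (≈ᴳ-sym p)
  ∼⇒⊑⊒ (mul {i} {x} {y}) =
      (λ w D → Null-cons (Deform-resp (G.sym i \\-∙)
        (Deform-uncons (Null-uncons D) ≈ᴳ-refl)))
    , (λ w D → Null-cons (letter y (Deform-resp \\-∙ (Null-uncons D))))
    where
    \\-∙ : G._≈_ i ((x ∙ y) \\ ε) (y \\ (x \\ ε))
    \\-∙ = G.trans i (G.∙-congʳ i (GP.⁻¹-anti-homo-∙ i x y)) (G.assoc i _ _ _)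
  ∼⇒⊑⊒ (unit {i}) =
      (λ w D → Deform-≈ᴳ (≈ᴳ-ε i λ₀) (Deform-resp (G.inverseˡ i ε) (Null-uncons D)))
    , (λ w D → Null-cons (Deform-resp (G.sym i (G.inverseˡ i ε)) (Deform-≈ᴳ (≈ᴳ-ε λ₀ i) D)))

  Null-resp-∼ : u ∼ v → Null u r → Null v r
  Null-resp-∼ {u} {v} {r} p D = ≡.subst (λ w → Null w r) (++-identityʳ v)
    (proj₁ (∼⇒⊑⊒ p) [] (≡.subst (λ w → Null w r) (≡.sym (++-identityʳ u)) D))

  -- Lower bounds for d̲

  Deform-[] : Deform [] i x r → dist i ε x ≤ r
  Deform-[] (nil p) = p

  Deform-dist : Deform ((i , z) ∷ []) j (ι j b) r → dist i z (ι i b) ≤ r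
  Deform-dist {i} {z} {j} {b} D =
    ≤.trans (≈⇒≥ (DP.d-ε-\\ i z (ι i b))) (Deform-[] (Deform-uncons D (≈ᴳ-ι j i b)))

  -- Either the letter is read in its own factor, or it forms a block with value `b` in `A`, and the
  -- cost is at least `through f (i , x) b`.
  d-≤-Deform : Deform (f ∷ []) i x r → d f (i , x) ≤ r
  d-≤-Deform {i = i} (letter g (nil p)) =
    ≤.trans (≈⇒≤ (ℝ.trans (d-common ≈ᴳ-refl ≈ᴳ-refl) (ℝ.sym (DP.d-ε-\\ i g _)))) p
  d-≤-Deform {f} {i} {x} (block [] [] b ≡.refl D₁ (nil q) p) =
    ≤.trans (d-≤-through f (i , x) b)
      (≤.trans (+-mono-≤ (Deform-dist D₁) (≤.trans (≈⇒≥ (DP.d-ε-\\ i _ x)) q)) p)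

  -- Rotating the inverse of `g` to the front and splitting it off leaves a deformation of `f` to
  -- `g`.
  d-≤-Null : ∀ f g → Null (f ∷ inv (g ∷ [])) r → d f g ≤ r
  d-≤-Null f g@(j , y) D = d-≤-Deform (Deform-resp
    (G.trans j (G.identityʳ j _) (GP.⁻¹-involutive j y))
    (Null-uncons (Null-rotate₁ f (invᴸ g ∷ []) D)))

  -- Replacing `g` by `f` raises the cost by at most `d f g`. It is phrased through lower bounds `x`
  -- because the infimum in `d` need not be attained.
  ≤-d-+ : ∀ f g w x y → (∀ c → Null (f ∷ w) (c + r) → x ≤ c + y) →
          Null (g ∷ w) r → x ≤ d f g + y
  ≤-d-+ f@(i , _) g@(j , _) w x y H D
    with lem {P = ∃[ i ] (InFactor i f × InFactor i g)}
  ... | yes (k , (y₁ , p) , (y₂ , q)) =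
        H _ (Null-resp-∼ (++-cong (letter (≈ᴳ-sym p)) ∼-refl)
              (Null-move (Null-resp-∼ (++-cong (letter q) ∼-refl) D)))
  ... | no _ = ≤-inf-+ (through f g) A.ε (through-nonNeg f g) (λ b →
        H (through f g b)
          (Deform-weaken (≈⇒≥ (ℝ.+-assoc _ _ _)) (Null-move (Null-resp-∼
            (++-cong (letter (≈ᴳ-ι j i b)) ∼-refl) (Null-move D)))))

  -- Letters are exchanged one at a time at the front. The head `g` is parked at the end of `v`
  -- during the recursion, and `t` accumulates the prices of the parked letters.
  ≤-ρ-+ : ∀ {n} (α β : Vec Letter n) v t x →
          (∀ r → Null (eval α ++ v) r → x ≤ t + r) →
          (∀ r → Null (eval β ++ v) r → x ≤ (ρ α β + t) + r)
  ≤-ρ-+ [] [] v t x H r D =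
    ≤.trans (H r D) (≈⇒≥ (ℝ.+-congʳ (ℝ.+-identityˡ t)))
  ≤-ρ-+ (f ∷ α) (g ∷ β) v t x H r D = ≤.trans
    (≤-ρ-+ α β (v ++ g ∷ []) (d f g + t) x tail r
      (≡.subst (λ w → Null w r) (++-assoc (eval β) v (g ∷ []))
        (Null-rotate₁ g (eval β ++ v) D)))
    (≈⇒≤ (ℝ.+-congʳ (ℝ.trans (x∙yz≈y∙xz _ _ _) (ℝ.sym (ℝ.+-assoc _ _ _)))))
    where
    head : ∀ s → Null (g ∷ eval α ++ v) s → x ≤ (d f g + t) + s
    head s D = ≤.trans
      (≤-d-+ f g (eval α ++ v) x (t + s)
        (λ c D → ≤.trans (H (c + s) D) (≈⇒≤ (x∙yz≈y∙xz t c s))) D)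
      (≈⇒≥ (ℝ.+-assoc _ _ _))

    tail : ∀ s → Null (eval α ++ (v ++ g ∷ [])) s → x ≤ (d f g + t) + s
    tail s D = head s (Null-rotate (eval α ++ v) (g ∷ [])
      (≡.subst (λ w → Null w s) (≡.sym (++-assoc (eval α) v (g ∷ []))) D))

  -- For any word pair, `eval α₂ ++ inv v` collapses at cost zero, and exchanging `α₂` for `α₁` adds
  -- at most `ρ α₁ α₂`.
  ≤-d̲ : ∀ u v x → (∀ r → Null (u ++ inv v) r → x ≤ r) → x ≤ d̲ u v
  ≤-d̲ u v x H = inf-greatest _ _ _ x bound
    where
    module _ (p : WordPair u v) where
      open WordPair p

      start : ∀ r → Null (eval α₁ ++ inv v) r → x ≤ 0# + r
      start r D = ≤.trans (H r (Null-resp-∼ (++-cong eval₁ ∼-refl) D))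
                          (≈⇒≥ (ℝ.+-identityˡ r))

      cancelled : [] ∼ eval α₂ ++ inv v
      cancelled = ∼-sym (∼-trans (++-cong eval₂ ∼-refl) (∐.inverseʳ v))

      bound : x ≤ ρ α₁ α₂
      bound = ≤.trans
        (≤-ρ-+ α₁ α₂ (inv v) 0# x start 0# (Null-resp-∼ cancelled Null-[]))
        (≤.trans x+0≤x x+0≤x)

  -- Upper bounds for d̲

  d̲-≤-ρ : ∀ {u v} (p : WordPair u v) → let open WordPair p in d̲ u v ≤ ρ α₁ α₂
  d̲-≤-ρ = inf-lower _ _ _

  d̲-η : ∀ f g → d̲ (η f) (η g) ≈ d f g
  d̲-η f g = ≤.antisym
    (≤.trans (d̲-≤-ρ record { α₁ = f ∷ [] ; α₂ = g ∷ []
                           ; eval₁ = ∼-refl ; eval₂ = ∼-refl })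
             x+0≤x)
    (≤-d̲ (η f) (η g) _ (λ r → d-≤-Null f g))

  ρ-refl : ∀ {n} (α : Vec Letter n) → ρ α α ≈ 0#
  ρ-refl []      = ℝ.refl
  ρ-refl (f ∷ α) = ℝ.trans (ℝ.+-cong (d-refl f) (ρ-refl α)) (ℝ.+-identityˡ 0#)

  ρ-sym-≤ : ∀ {n} (α β : Vec Letter n) → ρ α β ≤ ρ β α
  ρ-sym-≤ []      []      = ≤.refl
  ρ-sym-≤ (f ∷ α) (g ∷ β) = +-mono-≤ (d-sym-≤ f g) (ρ-sym-≤ α β)

  ρ-++ : ∀ {m n} (α α′ : Vec Letter m) (β β′ : Vec Letter n) →
         ρ (α Vec.++ β) (α′ Vec.++ β′) ≈ ρ α α′ + ρ β β′
  ρ-++ []      []       β β′ = ℝ.sym (ℝ.+-identityˡ _)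
  ρ-++ (f ∷ α) (g ∷ α′) β β′ =
    ℝ.trans (ℝ.+-congˡ (ρ-++ α α′ β β′)) (ℝ.sym (ℝ.+-assoc _ _ _))

  eval-++ : ∀ {m n} (α : Vec Letter m) (β : Vec Letter n) →
            eval (α Vec.++ β) ≡ eval α ++ eval β
  eval-++ []      β = ≡.refl
  eval-++ (f ∷ α) β = ≡.cong (f ∷_) (eval-++ α β)

  eval-fromList : ∀ w → eval (Vec.fromList w) ≡ w
  eval-fromList []      = ≡.refl
  eval-fromList (f ∷ w) = ≡.cong (f ∷_) (eval-fromList w)

  d̲-cong-≤ : ∀ {u u′ v v′} → u ∼ u′ → v ∼ v′ → d̲ u v ≤ d̲ u′ v′
  d̲-cong-≤ p q = inf-greatest _ _ _ _ λ w →
    let open WordPair w in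
    d̲-≤-ρ record { α₁ = α₁ ; α₂ = α₂
                 ; eval₁ = ∼-trans eval₁ (∼-sym p)
                 ; eval₂ = ∼-trans eval₂ (∼-sym q) }

  d̲-cong : ∀ {u u′ v v′} → u ∼ u′ → v ∼ v′ → d̲ u v ≈ d̲ u′ v′
  d̲-cong p q = ≤.antisym (d̲-cong-≤ p q) (d̲-cong-≤ (∼-sym p) (∼-sym q))

  d̲-sym-≤ : ∀ u v → d̲ u v ≤ d̲ v u
  d̲-sym-≤ u v = inf-greatest _ _ _ _ λ w →
    let open WordPair w in
    ≤.trans (d̲-≤-ρ record { α₁ = α₂ ; α₂ = α₁ ; eval₁ = eval₂ ; eval₂ = eval₁ })
            (ρ-sym-≤ α₂ α₁)

  d̲-nonNeg : ∀ u v → 0# ≤ d̲ u v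
  d̲-nonNeg u v = inf-nonNeg _ _ _

  d̲-refl-≤ : ∀ w → d̲ w w ≤ 0#
  d̲-refl-≤ w = ≤.trans
    (d̲-≤-ρ record { α₁ = α ; α₂ = α ; eval₁ = eval-α ; eval₂ = eval-α })
    (≈⇒≤ (ρ-refl α))
    where
    -- The leading identity letter keeps the word nonempty even when `w` is empty.
    α = (λ₀ , ε) ∷ Vec.fromList w

    eval-α : eval α ∼ w
    eval-α = ++-cong unit (∐.reflexive (eval-fromList w))

  -- Word pairs can be concatenated. Invariance and the triangle inequality are both derived from
  -- this.
  d̲-++ : ∀ u u′ v v′ → d̲ (u ++ v) (u′ ++ v′) ≤ d̲ u u′ + d̲ v v′
  d̲-++ u u′ v v′ = ≤-inf-+ _ _ _ λ p →
    ≤.trans (≤-inf-+ _ _ _ (λ q → ≤.trans (both p q) (≈⇒≤ (ℝ.+-comm _ _))))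
            (≈⇒≤ (ℝ.+-comm _ _))
    where
    module _ (p : WordPair u u′) (q : WordPair v v′) where
      open WordPair
      both : d̲ (u ++ v) (u′ ++ v′) ≤ ρ (α₁ p) (α₂ p) + ρ (α₁ q) (α₂ q)
      both = ≤.trans
        (d̲-≤-ρ record
          { α₁ = α₁ p Vec.++ α₁ q
          ; α₂ = α₂ p Vec.++ α₂ q
          ; eval₁ = ∼-trans (∐.reflexive (eval-++ (α₁ p) (α₁ q))) (++-cong (eval₁ p) (eval₁ q))
          ; eval₂ = ∼-trans (∐.reflexive (eval-++ (α₂ p) (α₂ q))) (++-cong (eval₂ p) (eval₂ q))
          })
        (≈⇒≤ (ρ-++ (α₁ p) (α₂ p) (α₁ q) (α₂ q)))

  d̲-left-≤ : ∀ w u v → d̲ (w ++ u) (w ++ v) ≤ d̲ u v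
  d̲-left-≤ w u v = ≤.trans (d̲-++ w w u v)
    (≤.trans (ℝ.+-monoˡ-≤ _ (d̲-refl-≤ w)) (≈⇒≤ (ℝ.+-identityˡ _)))

  d̲-right-≤ : ∀ w u v → d̲ (u ++ w) (v ++ w) ≤ d̲ u v
  d̲-right-≤ w u v = ≤.trans (d̲-++ u v w w)
    (≤.trans (+-monoʳ-≤ _ (d̲-refl-≤ w)) x+0≤x)

  private module ∐P = GroupProperties ∐

  d̲-left-invariant : ∀ w u v → d̲ (w ++ u) (w ++ v) ≈ d̲ u v
  d̲-left-invariant w u v = ≤.antisym (d̲-left-≤ w u v) (≤.trans
    -- The reverse inequality is the same one applied to translation by `inv w`.
    (d̲-cong-≤ (∼-sym (∐P.\\-leftDividesʳ w u)) (∼-sym (∐P.\\-leftDividesʳ w v)))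
    (d̲-left-≤ (inv w) (w ++ u) (w ++ v)))

  d̲-right-invariant : ∀ w u v → d̲ (u ++ w) (v ++ w) ≈ d̲ u v
  d̲-right-invariant w u v = ≤.antisym (d̲-right-≤ w u v) (≤.trans
    (d̲-cong-≤ (∼-sym (∐P.//-rightDividesʳ w u)) (∼-sym (∐P.//-rightDividesʳ w v)))
    (d̲-right-≤ (inv w) (u ++ w) (v ++ w)))

  d̲-triangle : ∀ u v w → d̲ u w ≤ d̲ u v + d̲ v w
  d̲-triangle u v w = begin
    d̲ u w                                     ≤⟨ d̲-cong-≤ (∼-sym u≈) (∼-sym w≈) ⟩
    d̲ ((u ++ inv v) ++ v) ((v ++ inv v) ++ w) ≤⟨ d̲-++ _ _ _ _ ⟩
    d̲ (u ++ inv v) (v ++ inv v) + d̲ v w       ≤⟨ ℝ.+-monoˡ-≤ _ (d̲-right-≤ (inv v) u v) ⟩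
    d̲ u v + d̲ v w                             ∎
    where
    open ≤-Reasoning

    u≈ : (u ++ inv v) ++ v ∼ u
    u≈ = ∐P.//-rightDividesˡ v u

    w≈ : (v ++ inv v) ++ w ∼ w
    w≈ = ∐.trans (∐.assoc v (inv v) w) (∐P.\\-leftDividesˡ v w)

  -- Positivity of d̲

  InA : Letter → Set (a ⊔ ℓ)
  InA (i , x) = ∃[ b ] (G._≈_ i x (ι i b))

  Separated : R → Letter → Set a
  Separated δ (i , x) = ∀ b → δ ≤ dist i x (ι i b)

  _≢ᶠ_ : Letter → Letter → Set l
  f ≢ᶠ g = proj₁ f ≢ proj₁ g

  -- Contrapositive of `A-closed`: if no positive `δ` separates the letter from `A`, then `A` has
  -- points arbitrarily close to it.
  ∉A⇒separated : ∀ f → ¬ InA f → ∃[ δ ] (0# < δ × Separated δ f)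
  ∉A⇒separated (i , x) x∉A with lem {P = ∃[ δ ] (0# < δ × Separated δ (i , x))}
  ... | yes p = p
  ... | no ∄δ = contradiction (A-closed i x approximate) x∉A
    where
    approximate : ∀ δ → 0# < δ → ∃[ b ] (dist i x (ι i b) < δ)
    approximate δ 0<δ with lem {P = ∃[ b ] (dist i x (ι i b) < δ)}
    ... | yes p = p
    ... | no ∄b = contradiction (δ , 0<δ , separated) ∄δ
      where
      separated : Separated δ (i , x)
      separated b with lem {P = δ ≤ dist i x (ι i b)}
      ... | yes p   = p
      ... | no  p = contradiction (b , ToStrict.≰⇒> _≈_ _≤_ ℝ.sym ≤.reflexive ≤.total p) ∄b

  ∉A⇒allSeparated : All (λ f → ¬ InA f) (f ∷ w) →
                    ∃[ δ ] (0# < δ × All (Separated δ) (f ∷ w))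
  ∉A⇒allSeparated (p ∷ []) =
    let δ , 0<δ , s = ∉A⇒separated _ p in δ , 0<δ , s ∷ []
  ∉A⇒allSeparated (p ∷ ps@(_ ∷ _)) with ∉A⇒separated _ p | ∉A⇒allSeparated ps
  ... | δ , 0<δ , s | δ′ , 0<δ′ , ss with ≤.total δ δ′
  ...   | inj₁ δ≤δ′ = δ  , 0<δ  , s ∷ All.map (λ s b → ≤.trans δ≤δ′ (s b)) ss
  ...   | inj₂ δ′≤δ = δ′ , 0<δ′ , (λ b → ≤.trans δ′≤δ (s b)) ∷ ss

  Linked-++⁻ˡ : ∀ u {v} → Linked _≢ᶠ_ (u ++ v) → Linked _≢ᶠ_ u
  Linked-++⁻ˡ []          _       = []
  Linked-++⁻ˡ (f ∷ [])    _       = [-]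
  Linked-++⁻ˡ (f ∷ g ∷ u) (p ∷ q) = p ∷ Linked-++⁻ˡ (g ∷ u) q

  module _ {δ : R} where

    -- A cheap deformation of an alternating word contains no blocks: an
    -- innermost block would be a single letter moved into A.
    cheap⇒oneFactor : All (Separated δ) w → Linked _≢ᶠ_ w → Deform w i x r →
                      δ ≤ r ⊎ All (λ f → proj₁ f ≡ i) w
    separated-≤ : All (Separated δ) (f ∷ w) → Linked _≢ᶠ_ (f ∷ w) →
                  Deform (f ∷ w) i (ι i b) r → δ ≤ r

    cheap⇒oneFactor _ _ (nil _) = inj₂ []
    cheap⇒oneFactor (_ ∷ ss) ls (letter g D) with cheap⇒oneFactor ss (Linked.tail ls) D
    ... | inj₁ δ≤r = inj₁ δ≤r
    ... | inj₂ ps  = inj₂ (≡.refl ∷ ps)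
    cheap⇒oneFactor (s ∷ ss) ls (block u v b ≡.refl D₁ D₂ p) = inj₁ (≤.trans
      (separated-≤ (s ∷ Allₚ.++⁻ˡ u ss) (Linked-++⁻ˡ (_ ∷ u) ls) D₁)
      (≤.trans (x≤x+nonNeg (Deform-nonNeg D₂)) p))

    separated-≤ ss ls D with cheap⇒oneFactor ss ls D
    separated-≤ _        _        D | inj₁ δ≤r                = δ≤r
    -- An alternating word inside one factor has just one letter, and moving that letter into `A`
    -- costs at least `δ`.
    separated-≤ (s ∷ []) _        D | inj₂ (_ ∷ [])           = ≤.trans (s _) (Deform-dist D)
    separated-≤ _        (p ∷ _)  D | inj₂ (≡.refl ∷ ≡.refl ∷ _) = contradiction ≡.refl p

  -- Reduced forms in the amalgamated product

  Reduced : List Letter → Set (l ⊔ c ⊔ ℓ ⊔ a)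
  Reduced w = All (λ f → ¬ InA f) w × Linked _≢ᶠ_ w

  ηᴬ : A.Carrier → Letter
  ηᴬ b = λ₀ , ι λ₀ b

  ReducedForm : List Letter → Set (l ⊔ c ⊔ ℓ ⊔ a)
  ReducedForm w = ∃[ b ] ∃[ v ] (w ∼ ηᴬ b ∷ v × Reduced v)

  ηᴬ-ε : ηᴬ A.ε ∷ [] ∼ []
  ηᴬ-ε = ∼-trans (letter (same (ιᴹ.ε-homo λ₀))) unit

  -- Only `f` can violate reducedness; if it lies in `A` it becomes the coefficient in front.
  reduce-linked : ∀ f v → All (λ f → ¬ InA f) v → Linked _≢ᶠ_ (f ∷ v) → ReducedForm (f ∷ v)
  reduce-linked f@(i , x) v ps ls with lem {P = InA f}
  ... | yes (b , x≈b) =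
        b , v , ++-cong (letter (glue b x≈b (G.refl λ₀))) ∼-refl , ps , Linked.tail ls
  ... | no x∉A = A.ε , f ∷ v , ++-cong (∼-sym ηᴬ-ε) ∼-refl , x∉A ∷ ps , ls

  reduce-∷ : ∀ f v → Reduced v → ReducedForm (f ∷ v)
  reduce-∷ f [] _ = reduce-linked f [] [] [-]
  reduce-∷ f@(i , x) (g@(j , y) ∷ v) (p ∷ ps , ls) with lem {P = i ≡ j}
  ... | no i≢j = reduce-linked f (g ∷ v) (p ∷ ps) (i≢j ∷ ls)
  ... | yes ≡.refl =
        -- The merged letter keeps the factor of `y`, so it still alternates with `v`, though it may
        -- have fallen into `A`.
        let b , v′ , q , red = reduce-linked (i , x ∙ y) v ps (relink ls)
        in b , v′ , ∼-trans (++-cong mul ∼-refl) q , red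
        where
        relink : ∀ {y z v} → Linked _≢ᶠ_ ((i , y) ∷ v) → Linked _≢ᶠ_ ((i , z) ∷ v)
        relink [-]      = [-]
        relink (p ∷ ls) = p ∷ ls

  reduce : ∀ w → ReducedForm w
  reduce [] = A.ε , [] , ∼-sym ηᴬ-ε , [] , []
  reduce ((i , x) ∷ w) =
    let b , v , p , red    = reduce w
        -- The coefficient `b` of the reduced tail is moved into factor `i` and absorbed by `x`.
        b′ , v′ , p′ , red′ = reduce-∷ (i , x ∙ ι i b) v red
    in b′ , v′
     , ∼-trans (++-cong {(i , x) ∷ []} ∼-refl
         (∼-trans p (++-cong (letter (≈ᴳ-ι λ₀ i b)) ∼-refl)))
       (∼-trans (++-cong (mul {i} {x} {ι i b}) ∼-refl) p′)
     , red′

  -- A nonempty reduced part of `u ++ inv v` would force `d̲ u v` to be at least some positive `δ`.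
  -- Otherwise `u ++ inv v` represents an element of `A`, whose distance to the identity is at most
  -- `d̲ u v`.
  d̲-0⇒∼ : ∀ u v → d̲ u v ≈ 0# → u ∼ v
  d̲-0⇒∼ u v d̲≈0 with reduce (u ++ inv v)
  ... | b , f ∷ w , p , ∉A , ls =
        let δ , 0<δ , ss = ∉A⇒allSeparated ∉A
            δ≤0 = ≤.trans (≤-d̲ u v δ (λ r D → separated-≤ {b = b A.\\ A.ε} ss ls
                    (Deform-resp (∙-ε b) (Null-uncons (Null-resp-∼ p D)))))
                    (≈⇒≤ d̲≈0)
        in contradiction δ≤0 (ToStrict.<⇒≱ _≈_ _≤_ ≤.antisym 0<δ)
        where
        ∙-ε : ∀ b → G._≈_ λ₀ (ι λ₀ b \\ ε) (ι λ₀ (b A.\\ A.ε))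
        ∙-ε b = G.sym λ₀ (G.trans λ₀ (ι-\\ λ₀ b A.ε) (G.∙-congˡ λ₀ (ιᴹ.ε-homo λ₀)))
  ... | b , [] , p , _ = ∐P.x∙y⁻¹≈ε⇒x≈y u v
        (∼-trans p (∼-trans (letter (same (D.0⇒≈ λ₀ dist≈0))) unit))
        where
        dist≈0 : dist λ₀ (ι λ₀ b) ε ≈ 0#
        dist≈0 = ≤.antisym
          (≤.trans (≤-d̲ u v _ (λ r D → ≤.trans (≈⇒≥ (DP.d-ε-\\ λ₀ _ _))
                     (Deform-[] (Null-uncons (Null-resp-∼ p D)))))
                   (≈⇒≤ d̲≈0))
          (D.nonNegative λ₀)

  d̲-isInvariantMetric : IsInvariantMetric ∐ d̲
  d̲-isInvariantMetric = record
    { isMetric = record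
      { isSemiMetric = record
        { isQuasiSemiMetric = record
          { isPreMetric = record
            { isProtoMetric = record
              { isPartialOrder  = ≤.isPartialOrder
              ; ≈-isEquivalence = ∐.isEquivalence
              ; cong            = d̲-cong
              ; nonNegative     = d̲-nonNeg _ _
              }
            ; ≈⇒0 = λ {u} {v} p → ≤.antisym
                (≤.trans (d̲-cong-≤ p ∼-refl) (d̲-refl-≤ v)) (d̲-nonNeg u v)
            }
          ; 0⇒≈ = d̲-0⇒∼ _ _
          }
        ; sym = λ u v → ≤.antisym (d̲-sym-≤ u v) (d̲-sym-≤ v u)
        }
      ; triangle = d̲-triangle
      }
    ; left-invariant  = d̲-left-invariant
    ; right-invariant = d̲-right-invariant
    }

mainTheorem1 : (lem : ∀ {p} → ExcludedMiddle p) (ℝ : CompleteOrderedField)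
    {l c ℓ a ℓₐ : Level} (M : MetricAmalgam ℝ l c ℓ a ℓₐ) →
    let open CompleteOrderedField ℝ using (_≈_)
        open Real ℝ using (IsInvariantMetric)
        open Amalgam lem ℝ M
    in IsInvariantMetric ∐ d̲ × (∀ g₁ g₂ → d̲ (η g₁) (η g₂) ≈ d g₁ g₂)
mainTheorem1 lem ℝ M = d̲-isInvariantMetric lem ℝ M , d̲-η lem ℝ M
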